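{- For every $r,\Delta \in \mathbb{Z}_{>0}$ with $r \geq 3$, we have \[ g(\Delta,r) \leq 130\, r^3 \Delta^{\frac{2}{r}}. \]
   Context: A matrix $A \in \mathbb{Z}^{r \times n}$ is called generic if all its $\operatorname{rank}(A) \times \operatorname{rank}(A)$ minors are non-zero. It is called $\Delta$-modular if all its $\operatorname{rank}(A) \times \operatorname{rank}(A)$ minors are bounded by $\Delta$ in absolute value and at least one such minor equals $\Delta$ or $-\Delta$. Matrices are assumed to have no repeated columns. Define \[ g(\Delta,r) := \max\{ n : \exists \text{ a generic } \Delta\text{ -modular } A \in \mathbb{Z}^{r \times n} \text{ with } \operatorname{rank}(A) = r\}. \] -}

module Defs where

open import Data.Nat as ℕ using (ℕ; zero; suc)
open import Data.Integer as ℤ using (ℤ; +_; -_; ∣_∣)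
open import Data.Fin using (Fin; zero; suc; punchIn; _<_)
open import Data.Product using (Σ; _×_; ∃; _,_)
open import Relation.Binary.PropositionalEquality using (_≡_; _≢_)
open import Data.Sum using (_⊎_)

Matrix : ℕ → ℕ → Set
Matrix r n = Fin r → Fin n → ℤ

sumFin : (n : ℕ) → (Fin n → ℤ) → ℤ
sumFin zero    f = + 0
sumFin (suc n) f = f zero ℤ.+ sumFin n (λ i → f (suc i))

sgn : ℕ → ℤ
sgn zero          = + 1
sgn (suc zero)    = - (+ 1)
sgn (suc (suc k)) = sgn k

det : (n : ℕ) → Matrix n n → ℤ
det zero    M = + 1
det (suc n) M =
  sumFin (suc n) (λ j →
    sgn (Data.Fin.toℕ j) ℤ.* (M zero j ℤ.* det n (λ i k → M (suc i) (punchIn j k))))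

ColumnChoice : ℕ → ℕ → Set
ColumnChoice r n = Σ (Fin r → Fin n) (λ σ → ∀ i j → i < j → σ i < σ j)

minor : {r n : ℕ} → Matrix r n → ColumnChoice r n → ℤ
minor {r} A (σ , _) = det r (λ i k → A i (σ k))

NoRepeatedColumns : {r n : ℕ} → Matrix r n → Set
NoRepeatedColumns {r} {n} A = ∀ (j k : Fin n) → (∀ i → A i j ≡ A i k) → j ≡ k

FullRowRank : {r n : ℕ} → Matrix r n → Set
FullRowRank {r} {n} A = Σ (ColumnChoice r n) (λ c → minor A c ≢ + 0)

Generic : {r n : ℕ} → Matrix r n → Set
Generic {r} {n} A = ∀ (c : ColumnChoice r n) → minor A c ≢ + 0

DeltaModular : {r n : ℕ} → ℕ → Matrix r n → Set
DeltaModular {r} {n} Δ A =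
  (∀ (c : ColumnChoice r n) → ∣ minor A c ∣ ℕ.≤ Δ)
  × Σ (ColumnChoice r n) (λ c → ∣ minor A c ∣ ≡ Δ)

{-# OPTIONS --safe #-}

-- Let σ be a choice of columns whose minor is ±Δ. The values (u·a_σ(1), …, u·a_σ(r)) of integer
-- linear forms u make up the row lattice of A restricted to σ, which has index Δ in ℤ^r. Hence the
-- box [0,M)^r contains at least M^r/Δ points of one coset, which gives K forms u_s whose differences
-- are at most M in absolute value on the columns of σ, and so at most rM on every column x by
-- Cramer's rule. If K = 2V with V = 2rM + 1, then by pigeonhole at least V pairs of forms agree on x.
-- On the other hand two distinct forms agree on fewer than r columns, since A is generic. Counting
-- the triples (x, s, t) in two ways gives n V ≤ K² r, so n = O(r² M), and M = 2rT with
-- T ≈ Δ^(2/r) is admissible.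
module Submission where

open import Defs
open import Data.Nat using (ℕ; _≤_; _*_; _^_)
open import Data.Product using (_×_)
open import Data.Nat as ℕ using (zero; suc; z≤n; s≤s)
import Data.Nat.Properties as ℕ
open import Data.Nat.Induction using (<-wellFounded)
import Data.Nat.Tactic.RingSolver as ℕ-ring
open import Data.Integer as ℤ using (ℤ; +_; -_; ∣_∣; 0ℤ)
import Data.Integer.Properties as ℤ
import Data.Integer.DivMod as ℤ
open import Data.Integer.Tactic.RingSolver using (solve-∀)
open import Data.Fin as Fin using (Fin; zero; suc; punchIn; punchOut; toℕ; _≟_; _<_; finToFun; funToFin)
open import Data.Fin.Properties as Fin using (any?; punchInᵢ≢i; punchIn-punchOut; punchIn-injective; punchOut-injective; suc-injective; toℕ-injective; toℕ-cast)
open import Data.List using (List; []; _∷_; _++_; map)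
open import Data.Product using (Σ; ∃; _,_; proj₁; proj₂)
open import Data.Sum using (_⊎_; inj₁; inj₂)
open import Data.Vec.Functional using (updateAt)
open import Data.Vec.Functional.Properties using (updateAt-updates; updateAt-minimal)
open import Algebra.Properties.AbelianGroup ℤ.+-0-abelianGroup using (∙-cancelʳ; inverseˡ-unique)
open import Algebra.Properties.CommutativeMonoid.Sum ℕ.+-0-commutativeMonoid using (sum; ∑-distrib-+; ∑-comm)
open import Function using (_∘_)
open import Induction.WellFounded using (Acc; acc)
open import Relation.Binary using (tri<; tri≈; tri>)
open import Relation.Nullary using (Dec; yes; no; contradiction; ¬?)
open import Relation.Nullary.Decidable using (decidable-stable)
open import Relation.Binary.PropositionalEquality using (_≡_; _≢_; refl; sym; trans; cong; cong₂; subst; subst₂; module ≡-Reasoning)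

private variable
  m n r : ℕ

-- Finite sums of integers.

sumFin-cong : ∀ n {f g : Fin n → ℤ} → (∀ i → f i ≡ g i) → sumFin n f ≡ sumFin n g
sumFin-cong zero    f≗g = refl
sumFin-cong (suc n) f≗g = cong₂ ℤ._+_ (f≗g zero) (sumFin-cong n (f≗g ∘ suc))

sumFin-linear : ∀ n (f g : Fin n → ℤ) c →
  sumFin n (λ i → f i ℤ.+ c ℤ.* g i) ≡ sumFin n f ℤ.+ c ℤ.* sumFin n g
sumFin-linear zero    f g c = sym (trans (ℤ.+-identityˡ _) (ℤ.*-zeroʳ c))
sumFin-linear (suc n) f g c = begin
  f zero ℤ.+ c ℤ.* g zero ℤ.+ sumFin n (λ i → f (suc i) ℤ.+ c ℤ.* g (suc i))
    ≡⟨ cong (λ s → f zero ℤ.+ c ℤ.* g zero ℤ.+ s) (sumFin-linear n (f ∘ suc) (g ∘ suc) c) ⟩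
  f zero ℤ.+ c ℤ.* g zero ℤ.+ (sumFin n (f ∘ suc) ℤ.+ c ℤ.* sumFin n (g ∘ suc))
    ≡⟨ regroup (f zero) (g zero) c (sumFin n (f ∘ suc)) (sumFin n (g ∘ suc)) ⟩
  sumFin (suc n) f ℤ.+ c ℤ.* sumFin (suc n) g ∎
  where
  open ≡-Reasoning
  regroup : ∀ x y c s t → x ℤ.+ c ℤ.* y ℤ.+ (s ℤ.+ c ℤ.* t) ≡ x ℤ.+ s ℤ.+ c ℤ.* (y ℤ.+ t)
  regroup = solve-∀

sumFin-zero : ∀ n {f : Fin n → ℤ} → (∀ i → f i ≡ 0ℤ) → sumFin n f ≡ 0ℤ
sumFin-zero zero    f≗0 = refl
sumFin-zero (suc n) f≗0 = cong₂ ℤ._+_ (f≗0 zero) (sumFin-zero n (f≗0 ∘ suc))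

sumFin-punchIn : ∀ n (f : Fin (suc n) → ℤ) k →
  sumFin (suc n) f ≡ f k ℤ.+ sumFin n (f ∘ punchIn k)
sumFin-punchIn n       f zero    = refl
sumFin-punchIn (suc n) f (suc k) = begin
  f zero ℤ.+ sumFin (suc n) (f ∘ suc)
    ≡⟨ cong (λ s → f zero ℤ.+ s) (sumFin-punchIn n (f ∘ suc) k) ⟩
  f zero ℤ.+ (f (suc k) ℤ.+ rest)  ≡⟨ swap (f zero) (f (suc k)) rest ⟩
  f (suc k) ℤ.+ (f zero ℤ.+ rest)  ∎
  where
  open ≡-Reasoning
  rest = sumFin n (f ∘ suc ∘ punchIn k)
  swap : ∀ x y z → x ℤ.+ (y ℤ.+ z) ≡ y ℤ.+ (x ℤ.+ z)
  swap = solve-∀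

-- Determinants as functions of the columns: linearity and equal neighbouring columns.

-- Neighbouring columns suffice: their Laplace terms have opposite signs, and Euclid's algorithm run
-- from the last column inwards combines no others. Both orders occur because a column may be added
-- to its left or to its right neighbour.
data Adjacent : ∀ {n} → Fin n → Fin n → Set where
  below : Adjacent {suc (suc n)} zero (suc zero)
  above : Adjacent {suc (suc n)} (suc zero) zero
  shift : {a b : Fin n} → Adjacent a b → Adjacent (suc a) (suc b)

adjacent⇒≢ : {a b : Fin n} → Adjacent a b → a ≢ b
adjacent⇒≢ (shift ab) refl = adjacent⇒≢ ab refl

sumFin-adjacent : {f : Fin n → ℤ} {a b : Fin n} → Adjacent a b → f a ℤ.+ f b ≡ 0ℤ →
  (∀ j → j ≢ a → j ≢ b → f j ≡ 0ℤ) → sumFin n f ≡ 0ℤ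
sumFin-adjacent {suc (suc n)} {f} below fab f0 = begin
  f zero ℤ.+ (f (suc zero) ℤ.+ rest)  ≡⟨ ℤ.+-assoc (f zero) (f (suc zero)) rest ⟨
  f zero ℤ.+ f (suc zero) ℤ.+ rest
    ≡⟨ cong₂ ℤ._+_ fab (sumFin-zero n (λ i → f0 (suc (suc i)) (λ ()) (λ ()))) ⟩
  0ℤ ∎
  where
  open ≡-Reasoning
  rest = sumFin n (λ i → f (suc (suc i)))
sumFin-adjacent {suc (suc n)} {f} above fab f0 =
  sumFin-adjacent below (trans (ℤ.+-comm (f zero) (f (suc zero))) fab) (λ j p q → f0 j q p)
sumFin-adjacent {suc n} {f} (shift ab) fab f0 =
  cong₂ ℤ._+_ (f0 zero (λ ()) (λ ()))
    (sumFin-adjacent ab fab (λ j p q → f0 (suc j) (p ∘ suc-injective) (q ∘ suc-injective)))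

punchIn-adjacent : (j : Fin (suc n)) {a b : Fin (suc n)} → Adjacent a b → j ≢ a → j ≢ b →
  Σ (Fin n) λ a′ → Σ (Fin n) λ b′ → Adjacent a′ b′ × punchIn j a′ ≡ a × punchIn j b′ ≡ b
punchIn-adjacent zero below j≢a j≢b = contradiction refl j≢a
punchIn-adjacent zero above j≢a j≢b = contradiction refl j≢b
punchIn-adjacent zero (shift {a = a} {b} ab) _ _ = a , b , ab , refl , refl
punchIn-adjacent (suc zero) below j≢a j≢b = contradiction refl j≢b
punchIn-adjacent (suc zero) above j≢a j≢b = contradiction refl j≢a
punchIn-adjacent {suc (suc n)} (suc (suc j)) below _ _ = zero , suc zero , below , refl , refl
punchIn-adjacent {suc (suc n)} (suc (suc j)) above _ _ = suc zero , zero , above , refl , refl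
punchIn-adjacent {suc n} (suc j) (shift ab) j≢a j≢b
  with a′ , b′ , ab′ , p , q ← punchIn-adjacent j ab (j≢a ∘ cong suc) (j≢b ∘ cong suc)
  = suc a′ , suc b′ , shift ab′ , cong suc p , cong suc q

-- When one of two equal neighbours is deleted, the other ends up at the same position in either
-- case.
punchIn-adjacent-≗ : {a b : Fin (suc n)} → Adjacent a b → (f : Fin (suc n) → ℤ) → f a ≡ f b →
  ∀ l → f (punchIn a l) ≡ f (punchIn b l)
punchIn-adjacent-≗ below f fab zero    = sym fab
punchIn-adjacent-≗ below f fab (suc l) = refl
punchIn-adjacent-≗ above f fab zero    = sym fab
punchIn-adjacent-≗ above f fab (suc l) = refl
punchIn-adjacent-≗ {suc n} (shift ab) f fab zero    = refl
punchIn-adjacent-≗ {suc n} (shift ab) f fab (suc l) = punchIn-adjacent-≗ ab (f ∘ suc) fab l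

sgn-suc : ∀ k → sgn (suc k) ≡ - sgn k
sgn-suc zero          = refl
sgn-suc (suc zero)    = refl
sgn-suc (suc (suc k)) = sgn-suc k

sgn-adjacent : {a b : Fin n} → Adjacent a b → sgn (toℕ b) ≡ - sgn (toℕ a)
sgn-adjacent below = refl
sgn-adjacent above = refl
sgn-adjacent (shift {a = a} {b} ab) = begin
  sgn (suc (toℕ b))  ≡⟨ sgn-suc (toℕ b) ⟩
  - sgn (toℕ b)      ≡⟨ cong -_ (sgn-adjacent ab) ⟩
  - - sgn (toℕ a)    ≡⟨ cong -_ (sgn-suc (toℕ a)) ⟨
  - sgn (suc (toℕ a)) ∎
  where open ≡-Reasoning

∣sgn∣≡1 : ∀ k → ∣ sgn k ∣ ≡ 1
∣sgn∣≡1 zero          = refl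
∣sgn∣≡1 (suc zero)    = refl
∣sgn∣≡1 (suc (suc k)) = ∣sgn∣≡1 k

cofactorMinor : Matrix (suc n) (suc n) → Fin (suc n) → Matrix n n
cofactorMinor M j i k = M (suc i) (punchIn j k)

laplaceTerm : Matrix (suc n) (suc n) → Fin (suc n) → ℤ
laplaceTerm {n} M j = sgn (toℕ j) ℤ.* (M zero j ℤ.* det n (cofactorMinor M j))

det-cong : ∀ n {M N : Matrix n n} → (∀ i j → M i j ≡ N i j) → det n M ≡ det n N
det-cong zero    M≗N = refl
det-cong (suc n) M≗N = sumFin-cong (suc n) λ j →
  cong (sgn (toℕ j) ℤ.*_) (cong₂ ℤ._*_ (M≗N zero j) (det-cong n λ i k → M≗N (suc i) (punchIn j k)))

-- In the expansion along the first row, the term `j = k` depends on column `k` only through its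
-- entry; every other term depends on it only through its cofactor, which is linear by induction.
det-linear-column : ∀ n (k : Fin n) {M N P : Matrix n n} c →
  (∀ i j → j ≢ k → P i j ≡ M i j) → (∀ i j → j ≢ k → P i j ≡ N i j) →
  (∀ i → P i k ≡ M i k ℤ.+ c ℤ.* N i k) → det n P ≡ det n M ℤ.+ c ℤ.* det n N
det-linear-column (suc n) k {M} {N} {P} c P≗M P≗N Pk =
  trans (sumFin-cong (suc n) term) (sumFin-linear (suc n) (laplaceTerm M) (laplaceTerm N) c)
  where
  open ≡-Reasoning
  pull : ∀ s x y c d → s ℤ.* ((x ℤ.+ c ℤ.* y) ℤ.* d) ≡ s ℤ.* (x ℤ.* d) ℤ.+ c ℤ.* (s ℤ.* (y ℤ.* d))
  pull = solve-∀
  push : ∀ s x c d e → s ℤ.* (x ℤ.* (d ℤ.+ c ℤ.* e)) ≡ s ℤ.* (x ℤ.* d) ℤ.+ c ℤ.* (s ℤ.* (x ℤ.* e))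
  push = solve-∀
  term : ∀ j → laplaceTerm P j ≡ laplaceTerm M j ℤ.+ c ℤ.* laplaceTerm N j
  term j with j ≟ k
  ... | yes refl = begin
    laplaceTerm P k
      ≡⟨ cong (λ x → sgn (toℕ k) ℤ.* (x ℤ.* det n (cofactorMinor P k))) (Pk zero) ⟩
    sgn (toℕ k) ℤ.* ((M zero k ℤ.+ c ℤ.* N zero k) ℤ.* det n (cofactorMinor P k))
      ≡⟨ pull (sgn (toℕ k)) (M zero k) (N zero k) c (det n (cofactorMinor P k)) ⟩
    sgn (toℕ k) ℤ.* (M zero k ℤ.* det n (cofactorMinor P k)) ℤ.+ c ℤ.* (sgn (toℕ k) ℤ.* (N zero k ℤ.* det n (cofactorMinor P k)))
      ≡⟨ cong₂ (λ d e → sgn (toℕ k) ℤ.* (M zero k ℤ.* d) ℤ.+ c ℤ.* (sgn (toℕ k) ℤ.* (N zero k ℤ.* e)))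
          (det-cong n (λ i l → P≗M (suc i) (punchIn k l) (punchInᵢ≢i k l)))
          (det-cong n (λ i l → P≗N (suc i) (punchIn k l) (punchInᵢ≢i k l))) ⟩
    laplaceTerm M k ℤ.+ c ℤ.* laplaceTerm N k ∎
  ... | no j≢k = begin
    laplaceTerm P j
      ≡⟨ cong (λ d → sgn (toℕ j) ℤ.* (P zero j ℤ.* d))
          (det-linear-column n k′ c (λ i l → P≗M (suc i) (punchIn j l) ∘ avoid l)
            (λ i l → P≗N (suc i) (punchIn j l) ∘ avoid l)
            (λ i → subst (λ z → P (suc i) z ≡ M (suc i) z ℤ.+ c ℤ.* N (suc i) z) (sym k′-eq) (Pk (suc i)))) ⟩
    sgn (toℕ j) ℤ.* (P zero j ℤ.* (det n (cofactorMinor M j) ℤ.+ c ℤ.* det n (cofactorMinor N j)))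
      ≡⟨ push (sgn (toℕ j)) (P zero j) c (det n (cofactorMinor M j)) (det n (cofactorMinor N j)) ⟩
    sgn (toℕ j) ℤ.* (P zero j ℤ.* det n (cofactorMinor M j)) ℤ.+ c ℤ.* (sgn (toℕ j) ℤ.* (P zero j ℤ.* det n (cofactorMinor N j)))
      ≡⟨ cong₂ (λ x y → sgn (toℕ j) ℤ.* (x ℤ.* det n (cofactorMinor M j)) ℤ.+ c ℤ.* (sgn (toℕ j) ℤ.* (y ℤ.* det n (cofactorMinor N j))))
          (P≗M zero j j≢k) (P≗N zero j j≢k) ⟩
    laplaceTerm M j ℤ.+ c ℤ.* laplaceTerm N j ∎
    where
    k′ = punchOut j≢k
    k′-eq : punchIn j k′ ≡ k
    k′-eq = punchIn-punchOut j≢k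
    avoid : ∀ l → l ≢ k′ → punchIn j l ≢ k
    avoid l l≢k′ eq = l≢k′ (punchIn-injective j l k′ (trans eq (sym k′-eq)))

-- The terms at `a` and `b` have equal entries and cofactors but opposite signs, so they cancel.
-- Every other cofactor still has two equal neighbouring columns and vanishes by induction.
det-equal-columns : ∀ n {M : Matrix n n} {a b : Fin n} → Adjacent a b → (∀ i → M i a ≡ M i b) → det n M ≡ 0ℤ
det-equal-columns (suc n) {M} {a} {b} ab Mab = sumFin-adjacent {f = laplaceTerm M} ab cancel vanish
  where
  open ≡-Reasoning
  opposite : ∀ s x d → s ℤ.* (x ℤ.* d) ℤ.+ (- s) ℤ.* (x ℤ.* d) ≡ 0ℤ
  opposite = solve-∀
  cancel : laplaceTerm M a ℤ.+ laplaceTerm M b ≡ 0ℤ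
  cancel = begin
    laplaceTerm M a ℤ.+ sgn (toℕ b) ℤ.* (M zero b ℤ.* det n (cofactorMinor M b))
      ≡⟨ cong₂ (λ s t → laplaceTerm M a ℤ.+ s ℤ.* t) (sgn-adjacent ab)
          (cong₂ ℤ._*_ (sym (Mab zero)) (det-cong n λ i l → sym (punchIn-adjacent-≗ ab (M (suc i)) (Mab (suc i)) l))) ⟩
    laplaceTerm M a ℤ.+ (- sgn (toℕ a)) ℤ.* (M zero a ℤ.* det n (cofactorMinor M a))
      ≡⟨ opposite (sgn (toℕ a)) (M zero a) (det n (cofactorMinor M a)) ⟩
    0ℤ ∎
  vanish : ∀ j → j ≢ a → j ≢ b → laplaceTerm M j ≡ 0ℤ
  vanish j j≢a j≢b with a′ , b′ , ab′ , refl , refl ← punchIn-adjacent j ab j≢a j≢b = begin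
    sgn (toℕ j) ℤ.* (M zero j ℤ.* det n (cofactorMinor M j))
      ≡⟨ cong (λ d → sgn (toℕ j) ℤ.* (M zero j ℤ.* d)) (det-equal-columns n ab′ (λ i → Mab (suc i))) ⟩
    sgn (toℕ j) ℤ.* (M zero j ℤ.* 0ℤ) ≡⟨ kill (sgn (toℕ j)) (M zero j) ⟩
    0ℤ ∎
    where
    kill : ∀ s x → s ℤ.* (x ℤ.* 0ℤ) ≡ 0ℤ
    kill = solve-∀

-- Elementary column operations.

record ColumnOp (n : ℕ) : Set where
  constructor op
  field
    {target source} : Fin n
    adjacent        : Adjacent target source
    factor          : ℤ
open ColumnOp

act : ColumnOp n → (Fin n → ℤ) → (Fin n → ℤ)
act e f = updateAt f (target e) (λ x → x ℤ.+ factor e ℤ.* f (source e))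

act-target : (e : ColumnOp n) (f : Fin n → ℤ) → act e f (target e) ≡ f (target e) ℤ.+ factor e ℤ.* f (source e)
act-target e f = updateAt-updates (target e) f

act-other : (e : ColumnOp n) (f : Fin n → ℤ) {j : Fin n} → j ≢ target e → act e f j ≡ f j
act-other e f {j} = updateAt-minimal j (target e) f

-- Linearity in the target column splits off `factor e` times the determinant of `copied`, which has
-- two equal columns.
det-act : (e : ColumnOp n) (M : Matrix n n) → det n (λ i → act e (M i)) ≡ det n M
det-act {n} e M = begin
  det n (λ i → act e (M i))
    ≡⟨ det-linear-column n (target e) {M} {copied} (factor e)
        (λ i j → act-other e (M i))
        (λ i j j≢a → trans (act-other e (M i) j≢a) (sym (updateAt-minimal j (target e) (M i) j≢a)))
        (λ i → trans (act-target e (M i)) (cong (λ x → M i (target e) ℤ.+ factor e ℤ.* x) (sym (updateAt-updates (target e) (M i))))) ⟩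
  det n M ℤ.+ factor e ℤ.* det n copied
    ≡⟨ cong (λ d → det n M ℤ.+ factor e ℤ.* d) (det-equal-columns n (adjacent e) copied-equal) ⟩
  det n M ℤ.+ factor e ℤ.* 0ℤ  ≡⟨ cong (λ z → det n M ℤ.+ z) (ℤ.*-zeroʳ (factor e)) ⟩
  det n M ℤ.+ 0ℤ               ≡⟨ ℤ.+-identityʳ (det n M) ⟩
  det n M ∎
  where
  open ≡-Reasoning
  copied : Matrix n n
  copied i = updateAt (M i) (target e) (λ _ → M i (source e))
  copied-equal : ∀ i → copied i (target e) ≡ copied i (source e)
  copied-equal i = trans (updateAt-updates (target e) (M i))
    (sym (updateAt-minimal (source e) (target e) (M i) (λ eq → adjacent⇒≢ (adjacent e) (sym eq))))

combination : (Fin m → ℤ) → Matrix m n → Fin n → ℤ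
combination {m} u M j = sumFin m (λ i → u i ℤ.* M i j)

act-cong : (e : ColumnOp n) {f g : Fin n → ℤ} → (∀ j → f j ≡ g j) → ∀ j → act e f j ≡ act e g j
act-cong e {f} {g} f≗g j with j ≟ target e
... | yes refl = trans (act-target e f) (trans (cong₂ (λ x y → x ℤ.+ factor e ℤ.* y) (f≗g _) (f≗g _)) (sym (act-target e g)))
... | no  j≢a  = trans (act-other e f j≢a) (trans (f≗g j) (sym (act-other e g j≢a)))

-- The source entry is left unchanged, so both vectors receive the same multiple at the target, and
-- it can be cancelled.
act-injective : (e : ColumnOp n) {f g : Fin n → ℤ} → (∀ j → act e f j ≡ act e g j) → ∀ j → f j ≡ g j
act-injective e {f} {g} eq j with j ≟ target e
... | no  j≢a  = trans (sym (act-other e f j≢a)) (trans (eq j) (act-other e g j≢a))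
... | yes refl = ∙-cancelʳ (factor e ℤ.* f (source e)) (f j) (g j) (begin
  f j ℤ.+ factor e ℤ.* f (source e) ≡⟨ act-target e f ⟨
  act e f j                         ≡⟨ eq j ⟩
  act e g j                         ≡⟨ act-target e g ⟩
  g j ℤ.+ factor e ℤ.* g (source e) ≡⟨ cong (λ x → g j ℤ.+ factor e ℤ.* x) fb≡gb ⟨
  g j ℤ.+ factor e ℤ.* f (source e) ∎)
  where
  open ≡-Reasoning
  b≢a : source e ≢ target e
  b≢a b≡a = adjacent⇒≢ (adjacent e) (sym b≡a)
  fb≡gb : f (source e) ≡ g (source e)
  fb≡gb = trans (sym (act-other e f b≢a)) (trans (eq (source e)) (act-other e g b≢a))

act-minus : (e : ColumnOp n) (f g : Fin n → ℤ) → ∀ j → act e (λ k → f k ℤ.- g k) j ≡ act e f j ℤ.- act e g j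
act-minus e f g j with j ≟ target e
... | no  j≢a  = trans (act-other e _ j≢a) (sym (cong₂ ℤ._-_ (act-other e f j≢a) (act-other e g j≢a)))
... | yes refl = trans (act-target e _) (trans (regroup (f j) (g j) (factor e) (f (source e)) (g (source e)))
                   (sym (cong₂ ℤ._-_ (act-target e f) (act-target e g))))
  where
  regroup : ∀ x y c z w → x ℤ.- y ℤ.+ c ℤ.* (z ℤ.- w) ≡ (x ℤ.+ c ℤ.* z) ℤ.- (y ℤ.+ c ℤ.* w)
  regroup = solve-∀

act-combination : (e : ColumnOp n) (u : Fin m → ℤ) (M : Matrix m n) →
  ∀ j → combination u (λ i → act e (M i)) j ≡ act e (combination u M) j
act-combination {m = m} e u M j with j ≟ target e
... | no  j≢a  = trans (sumFin-cong m λ i → cong (u i ℤ.*_) (act-other e (M i) j≢a)) (sym (act-other e (combination u M) j≢a))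
... | yes refl = begin
  sumFin m (λ i → u i ℤ.* act e (M i) j)
    ≡⟨ sumFin-cong m (λ i → trans (cong (u i ℤ.*_) (act-target e (M i))) (expand (u i) (M i j) (factor e) (M i (source e)))) ⟩
  sumFin m (λ i → u i ℤ.* M i j ℤ.+ factor e ℤ.* (u i ℤ.* M i (source e)))
    ≡⟨ sumFin-linear m _ _ (factor e) ⟩
  combination u M j ℤ.+ factor e ℤ.* combination u M (source e)
    ≡⟨ act-target e (combination u M) ⟨
  act e (combination u M) j ∎
  where
  open ≡-Reasoning
  expand : ∀ u x c y → u ℤ.* (x ℤ.+ c ℤ.* y) ≡ u ℤ.* x ℤ.+ c ℤ.* (u ℤ.* y)
  expand = solve-∀

-- Euclidean elimination in a row and the induction principle for square matrices that it gives.

actAll : List (ColumnOp n) → (Fin n → ℤ) → (Fin n → ℤ)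
actAll []       f = f
actAll (e ∷ es) f = actAll es (act e f)

actAll-++ : (es ds : List (ColumnOp n)) (f : Fin n → ℤ) → actAll (es ++ ds) f ≡ actAll ds (actAll es f)
actAll-++ []       ds f = refl
actAll-++ (e ∷ es) ds f = actAll-++ es ds (act e f)

shiftOp : ColumnOp n → ColumnOp (suc n)
shiftOp (op ab c) = op (shift ab) c

actAll-shift-zero : (es : List (ColumnOp n)) (f : Fin (suc n) → ℤ) → actAll (map shiftOp es) f zero ≡ f zero
actAll-shift-zero []       f = refl
actAll-shift-zero (e ∷ es) f = actAll-shift-zero es (act (shiftOp e) f)

actAll-shift-suc : (es : List (ColumnOp n)) (f : Fin (suc n) → ℤ) →
  ∀ j → actAll (map shiftOp es) f (suc j) ≡ actAll es (f ∘ suc) j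
actAll-shift-suc []       f j = refl
actAll-shift-suc (e ∷ es) f j = actAll-shift-suc es (act (shiftOp e) f) j

-- Euclid's algorithm on the first two entries, by well-founded induction on the absolute value of
-- the second. It adds multiples only and never swaps, so determinants keep their sign.
euclid : (f : Fin (suc (suc n)) → ℤ) → Acc ℕ._<_ ∣ f (suc zero) ∣ →
  Σ (List (ColumnOp (suc (suc n)))) λ es →
    actAll es f (suc zero) ≡ 0ℤ × (∀ j → actAll es f (suc (suc j)) ≡ f (suc (suc j)))
euclid f (acc rs) with f (suc zero) ℤ.≟ 0ℤ
... | yes b≡0 = [] , b≡0 , λ j → refl
... | no  b≢0 = let es , z , same = euclid f′ (rs smaller) in e ∷ d ∷ es , z , same
  where
  instance
    b-nonZero : ℤ.NonZero (f (suc zero))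
    b-nonZero = ℤ.≢-nonZero b≢0
  a = f zero
  b = f (suc zero)
  q = a ℤ./ b
  -- These two operations turn b into -(a - qb) = -(a mod b).
  e = op below (+ 1 ℤ.- q)
  d = op above (- (+ 1))
  f′ = act d (act e f)
  cancel : ∀ x q b → b ℤ.+ - (+ 1) ℤ.* ((x ℤ.+ q ℤ.* b) ℤ.+ (+ 1 ℤ.- q) ℤ.* b) ≡ - x
  cancel = solve-∀
  remainder : f′ (suc zero) ≡ - (+ (a ℤ.% b))
  remainder = trans
    (cong (λ x → b ℤ.+ - (+ 1) ℤ.* (x ℤ.+ (+ 1 ℤ.- q) ℤ.* b)) (ℤ.a≡a%n+[a/n]*n a b))
    (cancel (+ (a ℤ.% b)) q b)
  smaller : ∣ f′ (suc zero) ∣ ℕ.< ∣ b ∣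
  smaller = subst (ℕ._< ∣ b ∣) (sym (trans (cong ∣_∣ remainder) (ℤ.∣-i∣≡∣i∣ (+ (a ℤ.% b))))) (ℤ.n%d<d a b)

-- The recursion on the tail leaves at most one non-zero entry there, next to the head; `euclid`
-- then clears it against the head.
eliminate : (f : Fin (suc n) → ℤ) → ∃ λ es → ∀ j → actAll es f (suc j) ≡ 0ℤ
eliminate {zero}  f = [] , λ ()
eliminate {suc n} f
  with es , tail≡0 ← eliminate (f ∘ suc)
  with ds , second≡0 , same ← euclid (actAll (map shiftOp es) f) (<-wellFounded _)
  = map shiftOp es ++ ds , λ
  { zero    → trans (cong (λ g → g (suc zero)) (actAll-++ (map shiftOp es) ds f)) second≡0
  ; (suc j) → trans (cong (λ g → g (suc (suc j))) (actAll-++ (map shiftOp es) ds f))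
                (trans (same j) (trans (actAll-shift-suc es f (suc j)) (tail≡0 j))) }

det-block : (M : Matrix (suc n) (suc n)) → (∀ j → M zero (suc j) ≡ 0ℤ) →
  det (suc n) M ≡ M zero zero ℤ.* det n (λ i j → M (suc i) (suc j))
det-block {n} M row≡0 = begin
  + 1 ℤ.* d ℤ.+ sumFin n (λ j → laplaceTerm M (suc j))
    ≡⟨ cong₂ ℤ._+_ (ℤ.*-identityˡ d) (sumFin-zero n λ j →
         trans (cong (λ x → sgn (suc (toℕ j)) ℤ.* (x ℤ.* det n (cofactorMinor M (suc j)))) (row≡0 j))
           (ℤ.*-zeroʳ (sgn (suc (toℕ j))))) ⟩
  d ℤ.+ 0ℤ ≡⟨ ℤ.+-identityʳ d ⟩
  d ∎
  where
  open ≡-Reasoning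
  d = M zero zero ℤ.* det n (λ i j → M (suc i) (suc j))

-- A stand-in for the Hermite normal form: column operations bring the first row to `(g, 0, …, 0)`,
-- and the induction continues in the lower right block. A property then only has to pass through
-- the block step and be pulled back along a single operation.
column-induction : (P : ∀ n → Matrix n n → Set) →
  (∀ M → P 0 M) →
  (∀ {n} M → (∀ j → M zero (suc j) ≡ 0ℤ) → P n (λ i j → M (suc i) (suc j)) → P (suc n) M) →
  (∀ {n} e M → P n (λ i → act e (M i)) → P n M) →
  ∀ n M → P n M
column-induction P base block step zero    M = base M
column-induction P base block step (suc n) M with es , row≡0 ← eliminate (M zero) = undo es M row≡0
  where
  undo : ∀ es M → (∀ j → actAll es (M zero) (suc j) ≡ 0ℤ) → P (suc n) M
  undo []       M row≡0 = block M row≡0 (column-induction P base block step n _)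
  undo (e ∷ es) M row≡0 = step e M (undo es (λ i → act e (M i)) row≡0)

-- Linearly dependent rows and vanishing determinants.

Dependent : Matrix m n → Set
Dependent {m} M = Σ (Fin m → ℤ) λ u → (∃ λ i → u i ≢ 0ℤ) × (∀ j → combination u M j ≡ 0ℤ)

-- In block form, a relation with a non-zero coefficient below the first row restricts to the block.
-- Otherwise it involves the first row alone and forces the corner entry to be zero.
dependent⇒det≡0 : ∀ n (M : Matrix n n) → Dependent M → det n M ≡ 0ℤ
dependent⇒det≡0 = column-induction (λ n M → Dependent M → det n M ≡ 0ℤ) (λ { M (u , (() , _) , _) }) block step
  where
  drop-head : ∀ x y {s} → y ≡ 0ℤ → x ℤ.* y ℤ.+ s ≡ 0ℤ → s ≡ 0ℤ
  drop-head x y {s} refl eq = trans (sym (trans (cong (ℤ._+ s) (ℤ.*-zeroʳ x)) (ℤ.+-identityˡ s))) eq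

  block : ∀ {n} M → (∀ j → M zero (suc j) ≡ 0ℤ) →
    (Dependent (λ i j → M (suc i) (suc j)) → det n (λ i j → M (suc i) (suc j)) ≡ 0ℤ) →
    Dependent M → det (suc n) M ≡ 0ℤ
  block {n} M row≡0 ih (u , (i , ui≢0) , uM≡0)
    with any? (λ k → ¬? (u (suc k) ℤ.≟ 0ℤ))
  ... | yes (k , uk≢0) = trans (det-block M row≡0) (trans
          (cong (M zero zero ℤ.*_) (ih (u ∘ suc , (k , uk≢0) , λ j → drop-head (u zero) _ (row≡0 j) (uM≡0 (suc j)))))
          (ℤ.*-zeroʳ (M zero zero)))
  ... | no tail≡0 = trans (det-block M row≡0) (cong (ℤ._* det n (λ i j → M (suc i) (suc j))) corner≡0)
    where
    open ≡-Reasoning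
    usuc≡0 : ∀ k → u (suc k) ≡ 0ℤ
    usuc≡0 k = decidable-stable (u (suc k) ℤ.≟ 0ℤ) (λ uk≢0 → tail≡0 (k , uk≢0))
    u0≢0 : ∀ i → u i ≢ 0ℤ → u zero ≢ 0ℤ
    u0≢0 zero    ne = ne
    u0≢0 (suc k) ne = contradiction (usuc≡0 k) ne
    product≡0 : u zero ℤ.* M zero zero ≡ 0ℤ
    product≡0 = begin
      u zero ℤ.* M zero zero        ≡⟨ ℤ.+-identityʳ _ ⟨
      u zero ℤ.* M zero zero ℤ.+ 0ℤ
        ≡⟨ cong (λ s → u zero ℤ.* M zero zero ℤ.+ s) (sumFin-zero n λ k → cong (ℤ._* M (suc k) zero) (usuc≡0 k)) ⟨
      combination u M zero          ≡⟨ uM≡0 zero ⟩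
      0ℤ ∎
    corner≡0 : M zero zero ≡ 0ℤ
    corner≡0 with ℤ.i*j≡0⇒i≡0∨j≡0 (u zero) product≡0
    ... | inj₁ u0≡0 = contradiction u0≡0 (u0≢0 i ui≢0)
    ... | inj₂ m≡0  = m≡0

  step : ∀ {n} e M → (Dependent (λ i → act e (M i)) → det n (λ i → act e (M i)) ≡ 0ℤ) → Dependent M → det n M ≡ 0ℤ
  step e M ih (u , u≢0 , uM≡0) = trans (sym (det-act e M)) (ih (u , u≢0 , λ j →
    trans (act-combination e u M j) (trans (act-cong e uM≡0 j) (act-zero j))))
    where
    act-zero : ∀ j → act e (λ _ → 0ℤ) j ≡ 0ℤ
    act-zero j with j ≟ target e
    ... | yes refl = trans (act-target e _) (trans (ℤ.+-identityˡ _) (ℤ.*-zeroʳ (factor e)))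
    ... | no  j≢a  = act-other e _ j≢a

-- Division with remainder by the row lattice.

-- A witness that the row lattice of M has index at most |det M| in ℤⁿ. Choosing canonical quotients,
-- instead of asking only for equal classes to differ by a lattice vector, lets column-induction go through.
record RowLatticeDivision {n} (M : Matrix n n) : Set where
  field
    quotients : (Fin n → ℤ) → (Fin n → ℤ)
    residue   : (Fin n → ℤ) → Fin ∣ det n M ∣
  reduced : (Fin n → ℤ) → (Fin n → ℤ)
  reduced w j = w j ℤ.- combination (quotients w) M j
  field
    residue-determines : ∀ v w → residue v ≡ residue w → ∀ j → reduced v j ≡ reduced w j

-- In block form the tail of `w` is divided by the block first, and what is left of the head is then
-- divided by the corner `g`. The pair of remainders takes `∣ g ∣ * ∣ det n N ∣` values, which is
-- the absolute determinant. A column operation is undone by dividing `act e w` instead and using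
-- that `act e` is injective.
rowLatticeDivision : ∀ n (M : Matrix n n) → det n M ≢ 0ℤ → RowLatticeDivision M
rowLatticeDivision = column-induction (λ n M → det n M ≢ 0ℤ → RowLatticeDivision M) base block step
  where
  open RowLatticeDivision
  base : ∀ M → det 0 M ≢ 0ℤ → RowLatticeDivision M
  base M _ = record { quotients = λ _ () ; residue = λ _ → zero ; residue-determines = λ _ _ _ () }

  block : ∀ {n} M → (∀ j → M zero (suc j) ≡ 0ℤ) →
    (det n (λ i j → M (suc i) (suc j)) ≢ 0ℤ → RowLatticeDivision (λ i j → M (suc i) (suc j))) →
    det (suc n) M ≢ 0ℤ → RowLatticeDivision M
  block {n} M row≡0 ih det≢0 = record
    { quotients = quot
    ; residue = λ w → Fin.cast (sym det≡) (Fin.combine (Fin.fromℕ< (ℤ.n%d<d (head-rest w) g)) (residue D (w ∘ suc)))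
    ; residue-determines = determines }
    where
    open ≡-Reasoning
    N = λ i j → M (suc i) (suc j)
    g = M zero zero
    det≡ : ∣ det (suc n) M ∣ ≡ ∣ g ∣ ℕ.* ∣ det n N ∣
    det≡ = trans (cong ∣_∣ (det-block M row≡0)) (ℤ.abs-* g (det n N))
    instance
      g-nonZero : ℤ.NonZero g
      g-nonZero = ℤ.≢-nonZero {g} λ g≡0 → det≢0 (trans (det-block M row≡0) (cong (ℤ._* det n N) g≡0))
    D : RowLatticeDivision N
    D = ih λ d≡0 → det≢0 (trans (det-block M row≡0) (trans (cong (g ℤ.*_) d≡0) (ℤ.*-zeroʳ g)))
    tail-part : (Fin (suc n) → ℤ) → ℤ
    tail-part w = sumFin n (λ i → quotients D (w ∘ suc) i ℤ.* M (suc i) zero)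
    head-rest : (Fin (suc n) → ℤ) → ℤ
    head-rest w = w zero ℤ.- tail-part w
    quot : (Fin (suc n) → ℤ) → (Fin (suc n) → ℤ)
    quot w zero    = head-rest w ℤ./ g
    quot w (suc i) = quotients D (w ∘ suc) i
    reduced-zero : ∀ w → w zero ℤ.- combination (quot w) M zero ≡ + (head-rest w ℤ.% g)
    reduced-zero w = trans (regroup (w zero) (tail-part w) (head-rest w ℤ./ g ℤ.* g))
      (trans (cong (ℤ._- (head-rest w ℤ./ g ℤ.* g)) (ℤ.a≡a%n+[a/n]*n (head-rest w) g))
        (cancel (+ (head-rest w ℤ.% g)) (head-rest w ℤ./ g ℤ.* g)))
      where
      regroup : ∀ x t p → x ℤ.- (p ℤ.+ t) ≡ (x ℤ.- t) ℤ.- p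
      regroup = solve-∀
      cancel : ∀ r p → (r ℤ.+ p) ℤ.- p ≡ r
      cancel = solve-∀
    reduced-suc : ∀ w j → w (suc j) ℤ.- combination (quot w) M (suc j) ≡ reduced D (w ∘ suc) j
    reduced-suc w j = cong (λ s → w (suc j) ℤ.- s) (begin
      quot w zero ℤ.* M zero (suc j) ℤ.+ s ≡⟨ cong (λ x → quot w zero ℤ.* x ℤ.+ s) (row≡0 j) ⟩
      quot w zero ℤ.* 0ℤ ℤ.+ s            ≡⟨ cong (ℤ._+ s) (ℤ.*-zeroʳ (quot w zero)) ⟩
      0ℤ ℤ.+ s                            ≡⟨ ℤ.+-identityˡ s ⟩
      s ∎)
      where s = combination (quotients D (w ∘ suc)) N j
    determines : ∀ v w → _ → ∀ j → v j ℤ.- combination (quot v) M j ≡ w j ℤ.- combination (quot w) M j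
    determines v w eq j
      with p , q ← Fin.combine-injective (Fin.fromℕ< (ℤ.n%d<d (head-rest v) g)) (residue D (v ∘ suc)) (Fin.fromℕ< (ℤ.n%d<d (head-rest w) g)) (residue D (w ∘ suc))
             (toℕ-injective (trans (sym (toℕ-cast (sym det≡) _)) (trans (cong toℕ eq) (toℕ-cast (sym det≡) _))))
      with j
    ... | zero  = trans (reduced-zero v) (trans (cong +_ (Fin.fromℕ<-injective _ _ _ _ p)) (sym (reduced-zero w)))
    ... | suc k = trans (reduced-suc v k) (trans (residue-determines D (v ∘ suc) (w ∘ suc) q k) (sym (reduced-suc w k)))

  step : ∀ {n} e M → (det n (λ i → act e (M i)) ≢ 0ℤ → RowLatticeDivision (λ i → act e (M i))) →
    det n M ≢ 0ℤ → RowLatticeDivision M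
  step {n} e M ih det≢0 = record
    { quotients = quotients D ∘ act e
    ; residue = λ w → Fin.cast (cong ∣_∣ (det-act e M)) (residue D (act e w))
    ; residue-determines = λ v w eq → act-injective e λ j → trans (act-reduced v j) (trans
        (residue-determines D (act e v) (act e w)
          (toℕ-injective (trans (sym (toℕ-cast _ _)) (trans (cong toℕ eq) (toℕ-cast _ _)))) j)
        (sym (act-reduced w j))) }
    where
    D : RowLatticeDivision (λ i → act e (M i))
    D = ih (det≢0 ∘ trans (sym (det-act e M)))
    act-reduced : ∀ w j → act e (λ k → w k ℤ.- combination (quotients D (act e w)) M k) j ≡ reduced D (act e w) j
    act-reduced w j = trans (act-minus e w _ j)
      (cong (λ s → act e w j ℤ.- s) (sym (act-combination e (quotients D (act e w)) M j)))

-- Inserting a column into an increasing choice.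

Increasing : (Fin r → Fin n) → Set
Increasing σ = ∀ i j → i < j → σ i < σ j

consIncreasing : (x : Fin n) (σ : Fin r → Fin n) → (∀ l → x < σ l) → Increasing σ →
  ColumnChoice (suc r) n
consIncreasing {n} {r} x σ x<σ inc = τ , increasing
  where
  τ : Fin (suc r) → Fin n
  τ zero    = x
  τ (suc l) = σ l
  increasing : Increasing τ
  increasing zero    (suc j) _         = x<σ j
  increasing (suc i) (suc j) (s≤s i<j) = inc i j i<j

-- Minors are taken over increasing choices only, so a further column has to enter at its sorted
-- position `k`. Deleting that position recovers `σ`.
insert : (σ : ColumnChoice r n) (x : Fin n) → (∃ λ i → proj₁ σ i ≡ x) ⊎
  Σ (ColumnChoice (suc r) n) λ τ → ∃ λ k → proj₁ τ k ≡ x × (∀ l → proj₁ τ (punchIn k l) ≡ proj₁ σ l)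
insert {zero} (σ , inc) x = inj₂ (consIncreasing x σ (λ ()) inc , zero , refl , λ ())
insert {suc r} (σ , inc) x with Fin.<-cmp x (σ zero)
... | tri≈ _ refl _ = inj₁ (zero , refl)
... | tri< x<σ0 _ _ = inj₂ (consIncreasing x σ x<σ inc , zero , refl , λ l → refl)
  where
  x<σ : ∀ l → x < σ l
  x<σ zero    = x<σ0
  x<σ (suc l) = Fin.<-trans x<σ0 (inc zero (suc l) (s≤s z≤n))
... | tri> _ _ σ0<x with insert (σ ∘ suc , λ i j i<j → inc (suc i) (suc j) (s≤s i<j)) x
...   | inj₁ (i , eq) = inj₁ (suc i , eq)
...   | inj₂ ((τ , τ-inc) , k , τk≡x , rest) =
        inj₂ (consIncreasing (σ zero) τ σ0<τ τ-inc , suc k , τk≡x , λ { zero → refl ; (suc l) → rest l })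
  where
  σ0<τ : ∀ l → σ zero < τ l
  σ0<τ l with k ≟ l
  ... | yes refl = subst (σ zero <_) (sym τk≡x) σ0<x
  ... | no  k≢l  = subst (σ zero <_)
    (trans (sym (rest (punchOut k≢l))) (cong τ (punchIn-punchOut k≢l)))
    (inc zero (suc (punchOut k≢l)) (s≤s z≤n))

punchIn-increasing : (k : Fin (suc r)) → Increasing (punchIn k)
punchIn-increasing k i j i<j = ℕ.≰⇒> (λ le → ℕ.<⇒≱ i<j (Fin.punchIn-cancel-≤ k j i le))

-- Bounding a linear form on all columns by its values on a maximal minor.

∣sumFin∣≤ : ∀ n (f : Fin n → ℤ) b → (∀ i → ∣ f i ∣ ≤ b) → ∣ sumFin n f ∣ ≤ n * b
∣sumFin∣≤ zero    f b f≤b = z≤n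
∣sumFin∣≤ (suc n) f b f≤b = ℕ.≤-trans (ℤ.∣i+j∣≤∣i∣+∣j∣ (f zero) (sumFin n (f ∘ suc)))
  (ℕ.+-mono-≤ (f≤b zero) (∣sumFin∣≤ n (f ∘ suc) b (f≤b ∘ suc)))

combination-minus : (u v : Fin m → ℤ) (M : Matrix m n) → ∀ j →
  combination (λ i → u i ℤ.- v i) M j ≡ combination u M j ℤ.- combination v M j
combination-minus {m} u v M j = trans (sumFin-cong m λ i → expand (u i) (v i) (M i j))
  (trans (sumFin-linear m _ _ (- (+ 1))) (collapse (combination u M j) (combination v M j)))
  where
  expand : ∀ x y z → (x ℤ.- y) ℤ.* z ≡ x ℤ.* z ℤ.+ - (+ 1) ℤ.* (y ℤ.* z)
  expand = solve-∀
  collapse : ∀ x y → x ℤ.+ - (+ 1) ℤ.* y ≡ x ℤ.- y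
  collapse = solve-∀

-- Cramer's rule: expanding, along its first row, the vanishing determinant of the columns x and σ
-- bordered by the row u A writes det(σ) (u A)ₓ in terms of the other minors.
combination-bound : (A : Matrix r n) (Δ : ℕ) .{{_ : ℕ.NonZero Δ}} → (∀ c → ∣ minor A c ∣ ≤ Δ) →
  (σ : ColumnChoice r n) → ∣ minor A σ ∣ ≡ Δ → (u : Fin r → ℤ) (b : ℕ) →
  (∀ i → ∣ combination u A (proj₁ σ i) ∣ ≤ b) → ∀ x → ∣ combination u A x ∣ ≤ r * b
combination-bound {r} {n} A Δ minors≤Δ σ minor≡Δ u b small x with insert σ x
-- A column of `σ` satisfies the hypothesis directly, and `b ≤ suc r * b`.
combination-bound {suc r} A Δ minors≤Δ σ minor≡Δ u b small x | inj₁ (i , refl) = ℕ.m≤n⇒m≤n+o (r * b) (small i)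
combination-bound {r} {n} A Δ minors≤Δ σ minor≡Δ u b small x | inj₂ (τ , k , refl , rest) =
  ℕ.*-cancelʳ-≤ _ _ Δ (begin
    ∣ combination u A x ∣ * Δ              ≡⟨ abs-term k (trans (cong ∣_∣ (det-cong r λ i l → cong (A i) (rest l))) minor≡Δ) ⟨
    ∣ laplaceTerm N k ∣                    ≡⟨ cong ∣_∣ isolate ⟩
    ∣ - sumFin r (laplaceTerm N ∘ punchIn k) ∣ ≡⟨ ℤ.∣-i∣≡∣i∣ (sumFin r (laplaceTerm N ∘ punchIn k)) ⟩
    ∣ sumFin r (laplaceTerm N ∘ punchIn k) ∣ ≤⟨ ∣sumFin∣≤ r _ (b * Δ) other-term ⟩
    r * (b * Δ)                            ≡⟨ ℕ.*-assoc r b Δ ⟨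
    r * b * Δ                              ∎)
  where
  open ℕ.≤-Reasoning
  N : Matrix (suc r) (suc r)
  N zero    j = combination u A (proj₁ τ j)
  N (suc i) j = A i (proj₁ τ j)
  -- The first row of `N` is the combination of the others with coefficients `u`, so `-1` followed
  -- by `u` is a relation among the rows.
  e : Fin (suc r) → ℤ
  e zero    = - (+ 1)
  e (suc i) = u i
  det≡0 : det (suc r) N ≡ 0ℤ
  det≡0 = dependent⇒det≡0 (suc r) N (e , (zero , λ ()) , λ j → cancel (N zero j))
    where
    cancel : ∀ z → - (+ 1) ℤ.* z ℤ.+ z ≡ 0ℤ
    cancel = solve-∀
  isolate : laplaceTerm N k ≡ - sumFin r (laplaceTerm N ∘ punchIn k)
  isolate = inverseˡ-unique _ _ (trans (sym (sumFin-punchIn r (laplaceTerm N) k)) det≡0)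
  abs-laplace : ∀ j → ∣ laplaceTerm N j ∣ ≡ ∣ N zero j ∣ * ∣ det r (cofactorMinor N j) ∣
  abs-laplace j = trans (ℤ.abs-* (sgn (toℕ j)) t)
    (trans (cong (_* ∣ t ∣) (∣sgn∣≡1 (toℕ j))) (trans (ℕ.*-identityˡ ∣ t ∣) (ℤ.abs-* (N zero j) (det r (cofactorMinor N j)))))
    where t = N zero j ℤ.* det r (cofactorMinor N j)
  abs-term : ∀ j {d} → ∣ det r (cofactorMinor N j) ∣ ≡ d → ∣ laplaceTerm N j ∣ ≡ ∣ N zero j ∣ * d
  abs-term j refl = abs-laplace j
  other-term : ∀ l → ∣ laplaceTerm N (punchIn k l) ∣ ≤ b * Δ
  other-term l = ℕ.≤-trans (ℕ.≤-reflexive (abs-laplace (punchIn k l)))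
    (ℕ.*-mono-≤ (subst (λ y → ∣ combination u A y ∣ ≤ b) (sym (rest l)) (small l))
      -- Deleting any position of `τ` leaves an increasing choice, so this cofactor is again a minor
      -- of `A`.
      (minors≤Δ (proj₁ τ ∘ punchIn (punchIn k l) ,
        λ i j i<j → proj₂ τ _ _ (punchIn-increasing (punchIn k l) i j i<j))))

-- Counting with indicators, pigeonhole and colliding pairs.

⟦_⟧ : ∀ {P : Set} → Dec P → ℕ
⟦ yes _ ⟧ = 1
⟦ no  _ ⟧ = 0

⟦⟧-mono : ∀ {P Q : Set} (P? : Dec P) (Q? : Dec Q) → (P → Q) → ⟦ P? ⟧ ≤ ⟦ Q? ⟧
⟦⟧-mono (no _)  Q?      P⇒Q = z≤n
⟦⟧-mono (yes p) (yes _) P⇒Q = ℕ.≤-refl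
⟦⟧-mono (yes p) (no ¬q) P⇒Q = contradiction (P⇒Q p) ¬q

⟦⟧-true : ∀ {P : Set} (P? : Dec P) → P → 1 ≤ ⟦ P? ⟧
⟦⟧-true (yes _) p = ℕ.≤-refl
⟦⟧-true (no ¬p) p = contradiction p ¬p

sum-mono : ∀ n {f g : Fin n → ℕ} → (∀ i → f i ≤ g i) → sum f ≤ sum g
sum-mono zero    f≤g = z≤n
sum-mono (suc n) f≤g = ℕ.+-mono-≤ (f≤g zero) (sum-mono n (f≤g ∘ suc))

sum-const : ∀ n c → sum {n} (λ _ → c) ≡ n * c
sum-const zero    c = refl
sum-const (suc n) c = cong (c ℕ.+_) (sum-const n c)

term≤sum : ∀ n (f : Fin n → ℕ) i → f i ≤ sum f
term≤sum (suc n) f zero    = ℕ.m≤m+n (f zero) _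
term≤sum (suc n) f (suc i) = ℕ.≤-trans (term≤sum n (f ∘ suc) i) (ℕ.m≤n+m _ (f zero))

-- Scanning from the left keeps the choice increasing. It serves both to pick distinct box points in
-- one coset and to pick columns on which two forms agree.
choose : ∀ r n {P : Fin n → Set} (P? : ∀ x → Dec (P x)) → r ≤ sum (λ x → ⟦ P? x ⟧) →
  Σ (ColumnChoice r n) λ σ → ∀ i → P (proj₁ σ i)
choose zero    n       P? _ = ((λ ()) , λ ()) , λ ()
choose (suc r) (suc n) P? r≤ with P? zero
choose (suc r) (suc n) P? (s≤s r≤) | yes p with (σ , inc) , all ← choose r n (λ x → P? (suc x)) r≤
  = consIncreasing zero (suc ∘ σ) (λ _ → s≤s z≤n) (λ i j i<j → s≤s (inc i j i<j)) , λ { zero → p ; (suc i) → all i }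
choose (suc r) (suc n) P? r≤ | no _ with (σ , inc) , all ← choose (suc r) n (λ x → P? (suc x)) r≤
  = (suc ∘ σ , λ i j i<j → s≤s (inc i j i<j)) , all

-- If every fibre had at most `k` elements, summing the fibre sizes over the `D` values would give
-- `N ≤ D * k`.
pigeonhole-fibre : ∀ {N D k} (f : Fin N → Fin D) → D * k ℕ.< N →
  ∃ λ c → k ℕ.< sum (λ s → ⟦ f s ≟ c ⟧)
pigeonhole-fibre {N} {D} {k} f Dk<N with any? (λ c → k ℕ.<? sum (λ s → ⟦ f s ≟ c ⟧))
... | yes big  = big
... | no small = contradiction Dk<N (ℕ.≤⇒≯ (begin
  N                                       ≡⟨ ℕ.*-identityʳ N ⟨
  N * 1                                   ≡⟨ sum-const N 1 ⟨
  sum {N} (λ _ → 1)                       ≤⟨ sum-mono N (λ s → ℕ.≤-trans (⟦⟧-true (f s ≟ f s) refl) (term≤sum D _ (f s))) ⟩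
  sum (λ s → sum (λ c → ⟦ f s ≟ c ⟧))     ≡⟨ ∑-comm (λ s c → ⟦ f s ≟ c ⟧) ⟩
  sum (λ c → sum (λ s → ⟦ f s ≟ c ⟧))     ≤⟨ sum-mono D (λ c → ℕ.≮⇒≥ (λ big → small (c , big))) ⟩
  sum {D} (λ _ → k)                       ≡⟨ sum-const D k ⟩
  D * k                                   ∎))
  where open ℕ.≤-Reasoning

-- Only pairs with the larger index first are counted, so the diagonal is left out and each
-- two-element set occurs once.
countPairs : ∀ K {R : Fin K → Fin K → Set} → (∀ s t → Dec (R s t)) → ℕ
countPairs zero    R? = 0
countPairs (suc K) R? = sum (λ s → ⟦ R? (suc s) zero ⟧) ℕ.+ countPairs K (λ s t → R? (suc s) (suc t))

countPairs-mono : ∀ K {R S : Fin K → Fin K → Set} (R? : ∀ s t → Dec (R s t)) (S? : ∀ s t → Dec (S s t)) →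
  (∀ s t → R s t → S s t) → countPairs K R? ≤ countPairs K S?
countPairs-mono zero    R? S? R⇒S = z≤n
countPairs-mono (suc K) R? S? R⇒S = ℕ.+-mono-≤
  (sum-mono K (λ s → ⟦⟧-mono (R? (suc s) zero) (S? (suc s) zero) (R⇒S (suc s) zero)))
  (countPairs-mono K _ _ (λ s t → R⇒S (suc s) (suc t)))

-- By induction on `K`: if the value at `zero` recurs, it contributes at least one collision; if
-- not, that value can be removed from the codomain, which lowers `V` by one.
many-collisions : ∀ K V (f : Fin K → Fin V) → K ≤ V ℕ.+ countPairs K (λ s t → f s ≟ f t)
many-collisions zero    V f = z≤n
many-collisions (suc K) V f with any? (λ s → f (suc s) ≟ f zero)
... | yes (s , eq) = begin
  suc K                    ≤⟨ s≤s (many-collisions K V (f ∘ suc)) ⟩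
  suc (V ℕ.+ rest)         ≡⟨ ℕ.+-suc V rest ⟨
  V ℕ.+ suc rest           ≤⟨ ℕ.+-monoʳ-≤ V (ℕ.+-monoˡ-≤ rest (ℕ.≤-trans (⟦⟧-true (f (suc s) ≟ f zero) eq) (term≤sum K _ s))) ⟩
  V ℕ.+ countPairs (suc K) (λ s t → f s ≟ f t) ∎
  where
  open ℕ.≤-Reasoning
  rest = countPairs K (λ s t → f (suc s) ≟ f (suc t))
many-collisions (suc K) (suc V) f | no fresh = s≤s (ℕ.≤-trans (many-collisions K V g)
  (ℕ.+-monoʳ-≤ V (ℕ.≤-trans
    (countPairs-mono K (λ s t → g s ≟ g t) (λ s t → f (suc s) ≟ f (suc t)) (λ s t → punchOut-injective (f0≢ s) (f0≢ t)))
    (ℕ.m≤n+m _ _))))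
  where
  f0≢ : ∀ s → f zero ≢ f (suc s)
  f0≢ s eq = fresh (s , sym eq)
  g : Fin K → Fin V
  g s = punchOut (f0≢ s)
many-collisions (suc K) zero f | no fresh with () ← f zero

-- Exchanging the two summations bounds the total by `c` for each pair; the number of pairs is
-- estimated generously by `K * K`.
sum-countPairs≤ : ∀ n K c {R : Fin n → Fin K → Fin K → Set} (R? : ∀ x s t → Dec (R x s t)) →
  (∀ s t → s ≢ t → sum (λ x → ⟦ R? x s t ⟧) ≤ c) → sum (λ x → countPairs K (R? x)) ≤ K * (K * c)
sum-countPairs≤ n zero    c R? _ = ℕ.≤-reflexive (trans (sum-const n 0) (ℕ.*-zeroʳ n))
sum-countPairs≤ n (suc K) c R? R≤c = begin
  sum (λ x → first x ℕ.+ rest x)   ≡⟨ ∑-distrib-+ first rest ⟩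
  sum first ℕ.+ sum rest           ≡⟨ cong (ℕ._+ sum rest) (∑-comm (λ x s → ⟦ R? x (suc s) zero ⟧)) ⟩
  sum (λ s → sum (λ x → ⟦ R? x (suc s) zero ⟧)) ℕ.+ sum rest
    ≤⟨ ℕ.+-mono-≤ (ℕ.≤-trans (sum-mono K (λ s → R≤c (suc s) zero (λ ()))) (ℕ.≤-reflexive (sum-const K c)))
         (sum-countPairs≤ n K c (λ x s t → R? x (suc s) (suc t)) (λ s t s≢t → R≤c (suc s) (suc t) (s≢t ∘ suc-injective))) ⟩
  K * c ℕ.+ K * (K * c)            ≤⟨ ℕ.+-mono-≤ (ℕ.m≤n+m (K * c) c) (ℕ.*-monoʳ-≤ K (ℕ.m≤n+m (K * c) c)) ⟩
  suc K * (suc K * c)              ∎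
  where
  open ℕ.≤-Reasoning
  first = λ x → sum (λ s → ⟦ R? x (suc s) zero ⟧)
  rest  = λ x → countPairs K (λ s t → R? x (suc s) (suc t))

-- Encodings of box points and of bounded integers.

finToFun-injective : ∀ {M} r {s t : Fin (M ^ r)} → (∀ i → finToFun {M} {r} s i ≡ finToFun {M} {r} t i) → s ≡ t
finToFun-injective {M} r {s} {t} eq = trans (sym (Fin.funToFin-finToFin {r} {M} s))
  (trans (funToFin-cong r eq) (Fin.funToFin-finToFin {r} {M} t))
  where
  funToFin-cong : ∀ r {f g : Fin r → Fin M} → (∀ i → f i ≡ g i) → funToFin f ≡ funToFin g
  funToFin-cong zero    eq = refl
  funToFin-cong (suc r) eq = cong₂ Fin.combine (eq zero) (funToFin-cong r (eq ∘ suc))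

increasing⇒injective : (σ : ColumnChoice r n) {i j : Fin r} → proj₁ σ i ≡ proj₁ σ j → i ≡ j
increasing⇒injective (σ , inc) {i} {j} eq with Fin.<-cmp i j
... | tri≈ _ i≡j _ = i≡j
... | tri< i<j _ _ = contradiction eq (Fin.<⇒≢ (inc i j i<j))
... | tri> _ _ j<i = contradiction (sym eq) (Fin.<⇒≢ (inc j i j<i))

shift≥0 : ∀ {b} z → ∣ z ∣ ≤ b → 0ℤ ℤ.≤ z ℤ.+ + b
shift≥0 (+ k)      _   = ℤ.+≤+ z≤n
shift≥0 ℤ.-[1+ k ] k<b = subst (0ℤ ℤ.≤_) (sym (ℤ.⊖-≥ k<b)) (ℤ.+≤+ z≤n)

-- The code of `z` is `z + b`, which is non-negative, so the absolute value taken here loses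
-- nothing.
bounded→Fin : ∀ {b} z → ∣ z ∣ ≤ b → Fin (suc (b ℕ.+ b))
bounded→Fin {b} z z≤b = Fin.fromℕ< (s≤s (ℕ.≤-trans (ℤ.∣i+j∣≤∣i∣+∣j∣ z (+ b)) (ℕ.+-monoˡ-≤ b z≤b)))

bounded→Fin-injective : ∀ {b} y z (y≤b : ∣ y ∣ ≤ b) (z≤b : ∣ z ∣ ≤ b) →
  bounded→Fin y y≤b ≡ bounded→Fin z z≤b → y ≡ z
bounded→Fin-injective {b} y z y≤b z≤b eq = ∙-cancelʳ (+ b) y z (trans (sym (ℤ.0≤i⇒+∣i∣≡i (shift≥0 y y≤b)))
  (trans (cong +_ (Fin.fromℕ<-injective _ _ _ _ eq)) (ℤ.0≤i⇒+∣i∣≡i (shift≥0 z z≤b))))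

-- Double counting of columns and pairs of agreeing forms.

module _ (A : Matrix r n) (generic : Generic A) (Δ : ℕ) .{{_ : ℕ.NonZero Δ}}
         (minors≤Δ : ∀ c → ∣ minor A c ∣ ≤ Δ) (σ : ColumnChoice r n) (minor≡Δ : ∣ minor A σ ∣ ≡ Δ)
  where

  private
    B : Matrix r r
    B i j = A i (proj₁ σ j)
    open RowLatticeDivision (rowLatticeDivision r B (generic σ))

  -- `V` is the number of integers in `[-rM, rM]`, the range of the normalised forms on a column.
  -- The hypothesis says that the box `[0, M)^r` has more than `Δ * K` points, where `K = V + V`.
  column-count : ∀ M → let V = suc (r * M ℕ.+ r * M) in Δ * (V ℕ.+ V) ℕ.< M ^ r → n ≤ 4 * (V * r)
  column-count M enough = ℕ.*-cancelʳ-≤ n _ V (begin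
    n * V                              ≡⟨ sum-const n V ⟨
    -- With `K = V + V` forms taking `V` values, at least `K - V = V` pairs collide on every column.
    sum {n} (λ _ → V)                  ≤⟨ sum-mono n (λ x → ℕ.+-cancelˡ-≤ V _ _ (many-collisions K V (value x))) ⟩
    sum (λ x → countPairs K (λ s t → value x s ≟ value x t))
      ≤⟨ sum-countPairs≤ n K r (λ x s t → value x s ≟ value x t) few ⟩
    K * (K * r)                        ≡⟨ regroup V r ⟩
    4 * (V * r) * V                    ∎)
    where
    open ℕ.≤-Reasoning
    V = suc (r * M ℕ.+ r * M)
    K = V ℕ.+ V
    point : Fin (M ^ r) → Fin r → ℤ
    point s i = + toℕ (finToFun {M} {r} s i)
    fibre : ∃ λ c → K ℕ.< sum (λ s → ⟦ residue (point s) ≟ c ⟧)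
    -- There are `∣ det r B ∣` residues, which is `Δ`.
    fibre = pigeonhole-fibre (residue ∘ point) (subst (λ d → d * K ℕ.< M ^ r) (sym minor≡Δ) enough)
    picked : Σ (ColumnChoice K (M ^ r)) λ τ → ∀ s → residue (point (proj₁ τ s)) ≡ proj₁ fibre
    picked = choose K (M ^ r) (λ s → residue (point s) ≟ proj₁ fibre) (ℕ.<⇒≤ (proj₂ fibre))
    w u : Fin K → Fin r → ℤ
    w s = point (proj₁ (proj₁ picked) s)
    u s = quotients (w s)
    same-class : ∀ s t j → reduced (w s) j ≡ reduced (w t) j
    same-class s t = residue-determines (w s) (w t) (trans (proj₂ picked s) (sym (proj₂ picked t)))
    difference : Fin K → Fin K → Fin r → ℤ
    difference s t i = u s i ℤ.- u t i
    -- Points with the same residue have equal reductions, so on `σ` the forms differ exactly as the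
    -- box points do.
    on-σ : ∀ s t j → combination (difference s t) A (proj₁ σ j) ≡ w s j ℤ.- w t j
    on-σ s t j = trans (combination-minus (u s) (u t) A (proj₁ σ j))
      (exchange (w s j) (combination (u s) B j) (w t j) (combination (u t) B j) (same-class s t j))
      where
      exchange : ∀ a b c d → a ℤ.- b ≡ c ℤ.- d → b ℤ.- d ≡ a ℤ.- c
      exchange a b c d eq = trans (split a b d) (trans (cong (λ x → a ℤ.- x ℤ.- d) eq) (join a c d))
        where
        split : ∀ a b d → b ℤ.- d ≡ a ℤ.- (a ℤ.- b) ℤ.- d
        split = solve-∀
        join : ∀ a c d → a ℤ.- (c ℤ.- d) ℤ.- d ≡ a ℤ.- c
        join = solve-∀
    -- Only differences of forms are bounded, so the form with index `zero` is subtracted from all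
    -- of them; agreement of two forms is unaffected.
    small : ∀ s x → ∣ combination (difference s zero) A x ∣ ≤ r * M
    small s = combination-bound A Δ minors≤Δ σ minor≡Δ (difference s zero) M λ j →
      subst (λ z → ∣ z ∣ ≤ M) (sym (on-σ s zero j))
        (ℕ.≤-trans (ℕ.≤-trans (ℕ.≤-reflexive (cong ∣_∣ (ℤ.m-n≡m⊖n (toℕ (digit s j)) (toℕ (digit zero j))))) (ℤ.∣m⊝n∣≤m⊔n (toℕ (digit s j)) _))
          (ℕ.⊔-lub (ℕ.<⇒≤ (Fin.toℕ<n (digit s j))) (ℕ.<⇒≤ (Fin.toℕ<n (digit zero j)))))
      where
      digit : Fin K → Fin r → Fin M
      digit s = finToFun {M} {r} (proj₁ (proj₁ picked) s)
    value : Fin n → Fin K → Fin V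
    value x s = bounded→Fin (combination (difference s zero) A x) (small s x)
    -- Equal forms would come from equal box points, but the chosen points are pairwise distinct.
    distinct : ∀ s t → s ≢ t → ∃ λ i → difference s t i ≢ 0ℤ
    distinct s t s≢t with any? (λ i → ¬? (difference s t i ℤ.≟ 0ℤ))
    ... | yes found = found
    ... | no  none  = contradiction (increasing⇒injective (proj₁ picked) (finToFun-injective r λ i →
            toℕ-injective (ℤ.+-injective (ℤ.i-j≡0⇒i≡j (w s i) (w t i) (trans (sym (on-σ s t i))
              (sumFin-zero r λ k → cong (ℤ._* A k (proj₁ σ i)) (zeros k))))))) s≢t
      where
      zeros : ∀ k → difference s t k ≡ 0ℤ
      zeros k = decidable-stable (difference s t k ℤ.≟ 0ℤ) (λ ne → none (k , ne))
    -- If two forms agreed on `r` columns, their non-zero difference would be a relation among the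
    -- rows of that minor, contradicting genericity.
    few : ∀ s t → s ≢ t → sum (λ x → ⟦ value x s ≟ value x t ⟧) ≤ r
    few s t s≢t = ℕ.≮⇒≥ λ many →
      let τ , collide = choose r n (λ x → value x s ≟ value x t) (ℕ.<⇒≤ many)
      in generic τ (dependent⇒det≡0 r _ (difference s t , distinct s t s≢t , λ j → vanish (proj₁ τ j) (collide j)))
      where
      vanish : ∀ x → value x s ≡ value x t → combination (difference s t) A x ≡ 0ℤ
      vanish x eq = trans (combination-minus (u s) (u t) A x)
        (telescope (Cx s) (Cx t) (Cx zero) (trans (sym (combination-minus (u s) (u zero) A x))
          (trans (bounded→Fin-injective (combination (difference s zero) A x) (combination (difference t zero) A x) (small s x) (small t x) eq) (combination-minus (u t) (u zero) A x))))
        where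
        Cx : Fin K → ℤ
        Cx s = combination (u s) A x
        telescope : ∀ a b c → a ℤ.- c ≡ b ℤ.- c → a ℤ.- b ≡ 0ℤ
        telescope a b c eq = trans (split a b c) (trans (cong (ℤ._- (b ℤ.- c)) eq) (ℤ.+-inverseʳ (b ℤ.- c)))
          where
          split : ∀ a b c → a ℤ.- b ≡ (a ℤ.- c) ℤ.- (b ℤ.- c)
          split = solve-∀
    regroup : ∀ V r → (V ℕ.+ V) * ((V ℕ.+ V) * r) ≡ 4 * (V * r) * V
    regroup = ℕ-ring.solve-∀

-- Choosing the box size and estimating the constants.

^-distribʳ-* : ∀ r m n → (m * n) ^ r ≡ m ^ r * n ^ r
^-distribʳ-* zero    m n = refl
^-distribʳ-* (suc r) m n = trans (cong (m * n *_) (^-distribʳ-* r m n)) (interchange m n (m ^ r) (n ^ r))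
  where
  interchange : ∀ a b c d → a * b * (c * d) ≡ a * c * (b * d)
  interchange = ℕ-ring.solve-∀

-- Increasing `D` by one, `T` is doubled only when `T ^ r` falls below the new value. The doubling
-- multiplies `T ^ r` by `2 ^ r`, which is enough to reach `suc D` and stays within the upper bound.
approximate-root : ∀ r D → 1 ≤ r → 1 ≤ D → ∃ λ T → 1 ≤ T × D ≤ T ^ r × T ^ r ≤ 2 ^ r * D
approximate-root r (suc zero) 1≤r 1≤D =
  1 , ℕ.≤-refl , ℕ.≤-reflexive (sym (ℕ.^-zeroˡ r)) , subst₂ _≤_ (sym (ℕ.^-zeroˡ r)) (sym (ℕ.*-identityʳ (2 ^ r))) (ℕ.m^n>0 2 r)
approximate-root r (suc D@(suc _)) 1≤r 1≤D with T , 1≤T , D≤ , ≤2D ← approximate-root r D 1≤r (s≤s z≤n)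
  with suc D ℕ.≤? T ^ r
... | yes D<Tʳ = T , 1≤T , D<Tʳ , ℕ.≤-trans ≤2D (ℕ.*-monoʳ-≤ (2 ^ r) (ℕ.n≤1+n D))
... | no  D≮Tʳ = 2 * T , ℕ.≤-trans 1≤T (ℕ.m≤n*m T 2) , lower , upper
  where
  open ℕ.≤-Reasoning
  lower : suc D ≤ (2 * T) ^ r
  lower = begin
    suc D          ≤⟨ subst (suc D ≤_) (ℕ.*-comm D 2) (ℕ.m<m*n D 2 (s≤s (s≤s z≤n))) ⟩
    2 * D          ≤⟨ ℕ.*-mono-≤ (ℕ.^-monoʳ-≤ 2 1≤r) D≤ ⟩
    2 ^ r * T ^ r  ≡⟨ ^-distribʳ-* r 2 T ⟨
    (2 * T) ^ r    ∎
  upper : (2 * T) ^ r ≤ 2 ^ r * suc D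
  upper = begin
    (2 * T) ^ r    ≡⟨ ^-distribʳ-* r 2 T ⟩
    2 ^ r * T ^ r  ≤⟨ ℕ.*-monoʳ-≤ (2 ^ r) (ℕ.<⇒≤ (ℕ.≰⇒> D≮Tʳ)) ⟩
    2 ^ r * suc D  ∎

-- Since `suc d ≤ d + d`, the square of `Δ` is at most the square of `T ^ d`. This leaves one of the
-- `suc d` factors free for the box estimate.
root-lower-bound : ∀ Δ d T .{{_ : ℕ.NonZero T}} → 2 ≤ d → Δ ^ 2 ≤ T ^ suc d → Δ ≤ T ^ d
root-lower-bound Δ d T 2≤d Δ²≤Tʳ = ℕ.≮⇒≥ λ Tᵈ<Δ → ℕ.<⇒≱ (ℕ.*-mono-< Tᵈ<Δ Tᵈ<Δ) (begin
  Δ * Δ            ≡⟨ cong (Δ *_) (ℕ.*-identityʳ Δ) ⟨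
  Δ ^ 2            ≤⟨ Δ²≤Tʳ ⟩
  T ^ suc d        ≤⟨ ℕ.^-monoʳ-≤ T (ℕ.+-monoˡ-≤ d (ℕ.<⇒≤ 2≤d)) ⟩
  T ^ (d ℕ.+ d)    ≡⟨ ℕ.^-distribˡ-+-* T d d ⟩
  T ^ d * T ^ d    ∎)
  where open ℕ.≤-Reasoning

-- With `r = suc d`, the power `M ^ r` splits into `T ^ d`, which absorbs `Δ`, and
-- `(2 * r) ^ d * M`, which exceeds `V + V` because the latter is only linear in `M`.
box-large-enough : ∀ Δ .{{_ : ℕ.NonZero Δ}} r T .{{_ : ℕ.NonZero T}} → 3 ≤ r → Δ ^ 2 ≤ T ^ r →
  let M = 2 * r * T ; V = suc (r * M ℕ.+ r * M) in Δ * (V ℕ.+ V) ℕ.< M ^ r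
box-large-enough Δ r@(suc d) T (s≤s 2≤d) Δ²≤Tʳ = begin-strict
  Δ * (V ℕ.+ V)                     <⟨ ℕ.*-monoʳ-< Δ 2V<[2r]ᵈM ⟩
  Δ * ((2 * r) ^ d * M)             ≤⟨ ℕ.*-monoˡ-≤ ((2 * r) ^ d * M) (root-lower-bound Δ d T 2≤d Δ²≤Tʳ) ⟩
  T ^ d * ((2 * r) ^ d * M)         ≡⟨ rotate (T ^ d) ((2 * r) ^ d) M ⟩
  M * ((2 * r) ^ d * T ^ d)         ≡⟨ cong (M *_) (^-distribʳ-* d (2 * r) T) ⟨
  M ^ r                             ∎
  where
  open ℕ.≤-Reasoning
  M V : ℕ
  M = 2 * r * T
  V = suc (r * M ℕ.+ r * M)
  1≤rM : 1 ≤ r * M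
  1≤rM = ℕ.*-mono-≤ {1} {r} (s≤s z≤n) (ℕ.*-mono-≤ {1} {2 * r} (s≤s z≤n) (ℕ.>-nonZero⁻¹ T))
  rotate : ∀ a b c → a * (b * c) ≡ c * (b * a)
  rotate = ℕ-ring.solve-∀
  double : ∀ x → suc (x ℕ.+ x) ℕ.+ suc (x ℕ.+ x) ≡ 4 * x ℕ.+ 2
  double = ℕ-ring.solve-∀
  product : ∀ r M → 4 * (r * M) ℕ.+ 8 * (r * M) ≡ 2 * r * (2 * 3) * M
  product = ℕ-ring.solve-∀
  2V<[2r]ᵈM : V ℕ.+ V ℕ.< (2 * r) ^ d * M
  2V<[2r]ᵈM = begin-strict
    V ℕ.+ V                       ≡⟨ double (r * M) ⟩
    -- The slack `8 * (r * M)` brings the sum to `12 * (r * M)`, that is `2 * r * 6 * M`, where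
    -- `6 ≤ 2 * r`.
    4 * (r * M) ℕ.+ 2             <⟨ ℕ.+-monoʳ-< (4 * (r * M)) (ℕ.*-mono-≤ {3} {8} (s≤s (s≤s (s≤s z≤n))) 1≤rM) ⟩
    4 * (r * M) ℕ.+ 8 * (r * M)   ≡⟨ product r M ⟩
    2 * r * (2 * 3) * M           ≤⟨ ℕ.*-monoˡ-≤ M (ℕ.*-monoʳ-≤ (2 * r) (ℕ.*-monoʳ-≤ 2 (s≤s 2≤d))) ⟩
    2 * r * (2 * r) * M           ≡⟨ cong (λ x → 2 * r * x * M) (ℕ.*-identityʳ (2 * r)) ⟨
    (2 * r) ^ 2 * M               ≤⟨ ℕ.*-monoˡ-≤ M (ℕ.^-monoʳ-≤ (2 * r) 2≤d) ⟩
    (2 * r) ^ d * M               ∎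

column-count-linear : ∀ r T → 1 ≤ r → 1 ≤ T →
  let M = 2 * r * T ; V = suc (r * M ℕ.+ r * M) in 4 * (V * r) ≤ 65 * r ^ 3 * T
column-count-linear r T 1≤r 1≤T = begin
  4 * (V * r)                               ≤⟨ ℕ.*-monoʳ-≤ 4 (ℕ.*-monoˡ-≤ r (ℕ.+-monoˡ-≤ (r * M ℕ.+ r * M) 1≤rM)) ⟩
  4 * ((r * M ℕ.+ (r * M ℕ.+ r * M)) * r)   ≡⟨ collect r T ⟩
  -- The constant `65` is half of `130`; the other factor of two pays for the approximate root, as
  -- `T ^ r ≤ 2 ^ r * Δ ^ 2`.
  24 * (r ^ 3 * T)                          ≤⟨ ℕ.*-monoˡ-≤ (r ^ 3 * T) (ℕ.m≤m+n 24 41) ⟩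
  65 * (r ^ 3 * T)                          ≡⟨ ℕ.*-assoc 65 (r ^ 3) T ⟨
  65 * r ^ 3 * T                            ∎
  where
  open ℕ.≤-Reasoning
  M V : ℕ
  M = 2 * r * T
  V = suc (r * M ℕ.+ r * M)
  1≤rM : 1 ≤ r * M
  1≤rM = ℕ.*-mono-≤ 1≤r (ℕ.*-mono-≤ (ℕ.≤-trans 1≤r (ℕ.m≤n*m r 2)) 1≤T)
  collect : ∀ r T → 4 * ((r * (2 * r * T) ℕ.+ (r * (2 * r * T) ℕ.+ r * (2 * r * T))) * r) ≡ 24 * (r * (r * (r * 1)) * T)
  collect = ℕ-ring.solve-∀

raise-to-power : ∀ n r T Δ → n ≤ 65 * r ^ 3 * T → T ^ r ≤ 2 ^ r * Δ ^ 2 →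
  n ^ r ≤ (130 ^ r) * (r ^ (3 * r)) * (Δ ^ 2)
raise-to-power n r T Δ n≤ Tʳ≤ = begin
  n ^ r                                      ≤⟨ ℕ.^-monoˡ-≤ r n≤ ⟩
  (65 * r ^ 3 * T) ^ r                       ≡⟨ ^-distribʳ-* r (65 * r ^ 3) T ⟩
  (65 * r ^ 3) ^ r * T ^ r                   ≡⟨ cong (_* T ^ r) (^-distribʳ-* r 65 (r ^ 3)) ⟩
  65 ^ r * (r ^ 3) ^ r * T ^ r               ≡⟨ cong (λ x → 65 ^ r * x * T ^ r) (ℕ.^-*-assoc r 3 r) ⟩
  65 ^ r * r ^ (3 * r) * T ^ r               ≤⟨ ℕ.*-monoʳ-≤ (65 ^ r * r ^ (3 * r)) Tʳ≤ ⟩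
  65 ^ r * r ^ (3 * r) * (2 ^ r * Δ ^ 2)     ≡⟨ regroup (65 ^ r) (r ^ (3 * r)) (2 ^ r) (Δ ^ 2) ⟩
  65 ^ r * 2 ^ r * r ^ (3 * r) * Δ ^ 2       ≡⟨ cong (λ x → x * r ^ (3 * r) * Δ ^ 2) (^-distribʳ-* r 65 2) ⟨
  130 ^ r * r ^ (3 * r) * Δ ^ 2              ∎
  where
  open ℕ.≤-Reasoning
  regroup : ∀ a b c d → a * b * (c * d) ≡ a * c * b * d
  regroup = ℕ-ring.solve-∀

-- The bound is stated for the `r`-th power of `n`, which replaces the real exponent `2/r` by an
-- inequality of natural numbers. A bound on the maximum is a bound for every admissible `n`.
theorem1p4 : ∀ (Δ r n : ℕ) → 1 ≤ Δ → 3 ≤ r → (A : Matrix r n) →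
    NoRepeatedColumns A → FullRowRank A → Generic A → DeltaModular Δ A →
    n ^ r ≤ (130 ^ r) * (r ^ (3 * r)) * (Δ ^ 2)
theorem1p4 Δ r n 1≤Δ 3≤r A _ _ generic (minors≤Δ , σ , minor≡Δ)
  with T , 1≤T , Δ²≤Tʳ , Tʳ≤2ʳΔ² ← approximate-root r (Δ ^ 2) (ℕ.≤-trans (s≤s z≤n) 3≤r) (ℕ.m^n>0 Δ {{ℕ.>-nonZero 1≤Δ}} 2)
  = raise-to-power n r T Δ
      (ℕ.≤-trans
        (column-count A generic Δ minors≤Δ σ minor≡Δ (2 * r * T) (box-large-enough Δ r T {{ℕ.>-nonZero 1≤T}} 3≤r Δ²≤Tʳ))
        (column-count-linear r T (ℕ.≤-trans (s≤s z≤n) 3≤r) 1≤T))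
      Tʳ≤2ʳΔ²
  where
  instance
    Δ-nonZero : ℕ.NonZero Δ
    Δ-nonZero = ℕ.>-nonZero 1≤Δ
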